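{- Let $\mathcal{B}$ be a set and let $H,H'\subseteq 2^{\mathcal{B}}$ be downward-closed compsets. Then the quotient $H_q=H/H'$, i.e. the largest downward-closed compset $H_q$ with $H'\times H_q\subseteq H$, is $$H_q=\left\langle \bigcap_{M'\in\overline{H'}}\frac{\phi(M')}{M'}\right\rangle_{\phi:\overline{H'}\to\overline{H}},$$ where $\phi$ ranges over all functions from $\overline{H'}$ to $\overline{H}$, i.e. over all choices of a maximal component $\phi(M')\in\overline{H}$ for each $M'\in\overline{H'}$. Thus, if $H$ is $k$-conic and $H'$ is $k'$-conic, then the number of maximal components of $H/H'$ is bounded from above by $k^{k'}$.
   Context: Components are subsets of a fixed set $\mathcal{B}$ of behaviors, ordered by inclusion, with composition given by intersection; the quotient of components is the implication $\frac{M}{M'}=M\cup(\mathcal{B}\setminus M')$, the largest component whose intersection with $M'$ is contained in $M$. A compset is a set of components $H\subseteq 2^{\mathcal{B}}$; it is downward-closed if $M'\subseteq M\in H$ implies $M'\in H$. $\overline{H}=\{M\in H : \forall M'\in H,\ M\subseteq M'\Rightarrow M'=M\}$ is the set of maximal components of $H$. A downward-closed compset $H$ is called $k$-conic if $\overline{H}$ is finite of cardinality $k$. Here $2^M$ is the set of all subsets of $M$, and $\langle M_i\rangle_{i}$ denotes the downward-closed compset $\bigcup_i 2^{M_i}$. Composition of compsets is $H\times H'=\{M\cap M' : M\in H,\ M'\in H'\}$.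
   Formalization: H and H' are additionally assumed to be generated by their maximal components (every component lies below a maximal one); without this the claim fails, e.g. for H the finite subsets of ℕ and H' = 2^ℕ, where the formula gives ∅ but H/H' = H. -}

module Defs where

open import Level using (Level; suc; _⊔_)
open import Data.Fin using (Fin)
open import Data.Nat using (ℕ)
open import Data.Product using (∃; Σ-syntax; ∃-syntax; _×_; proj₁)
open import Function.Bundles using (Func; Inverse; _⟨$⟩_)
open import Relation.Binary.Bundles using (Setoid)
open import Relation.Binary.Core using (REL)
open import Relation.Binary.Definitions using (_Respectsˡ_; _Respectsʳ_)
open import Relation.Binary.PropositionalEquality using (setoid)
open import Relation.Unary
  using (Pred; _∈_; _⊆_; _≐_; _∩_; _∪_; ∁; ⋂; ⋃)
open import Relation.Unary.Relation.Binary.Equality using (≐-setoid)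
import Relation.Binary.Construct.On as On

-- Subsets are predicates and are compared by extensional equality _≐_.  Since
-- nothing identifies extensionally equal predicates, a set of subsets is
-- regarded as a setoid, and functions between such sets must respect _≐_
-- (`Func`).

-- The axiom of choice in its set-theoretic strength: the choice function
-- respects the equalities of the two setoids.  (Over bare types, choice is a
-- triviality of Σ, but the resulting function need not respect equality.)
Choice : ∀ c ℓ r → Set (suc (c ⊔ ℓ ⊔ r))
Choice c ℓ r =
  (A B : Setoid c ℓ) →
  let module A = Setoid A; module B = Setoid B in
  (R : REL A.Carrier B.Carrier r) →
  R Respectsˡ A._≈_ → R Respectsʳ B._≈_ →
  (∀ x → ∃[ y ] R x y) →
  Σ[ f ∈ Func A B ] (∀ x → R x (f ⟨$⟩ x))

module _ {ℓ : Level} (ℬ : Set ℓ) where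

  Component : Set (suc ℓ)
  Component = Pred ℬ ℓ

  Compset : Set (suc (suc ℓ))
  Compset = Pred Component (suc ℓ)

module _ {ℓ : Level} {ℬ : Set ℓ} where

  infix 8 _÷_
  infixr 7 _⊗_

  _÷_ : ∀ {j} → Pred ℬ j → Pred ℬ j → Pred ℬ j
  M ÷ M′ = M ∪ ∁ M′

  DownwardClosed : Compset ℬ → Set (suc ℓ)
  DownwardClosed H = ∀ {M M′ : Component ℬ} → M′ ⊆ M → M ∈ H → M′ ∈ H

  _⊗_ : Compset ℬ → Compset ℬ → Compset ℬ
  (H ⊗ H′) X = ∃[ M ] ∃[ M′ ] (M ∈ H × M′ ∈ H′ × X ≐ (M ∩ M′))

  maximal : Compset ℬ → Compset ℬ
  maximal H M = M ∈ H × (∀ {M′} → M′ ∈ H → M ⊆ M′ → M′ ≐ M)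

  -- The set of maximal components as a type; an element is a component
  -- together with a proof of maximality, and the proof is ignored by equality.
  Maximals : Compset ℬ → Setoid (suc ℓ) ℓ
  Maximals H = On.setoid {B = ∃ (maximal H)} (≐-setoid ℬ ℓ) proj₁

  -- M may live in a higher universe than components do: an intersection indexed
  -- by a set of components does so.  The members of 2^ M are still components.
  2^_ : ∀ {j} → Pred ℬ j → Pred (Component ℬ) (ℓ ⊔ j)
  (2^ M) M′ = M′ ⊆ M

  ⟨_⟩ : ∀ {i j} {I : Set i} → (I → Pred ℬ j) → Pred (Component ℬ) (i ⊔ ℓ ⊔ j)
  ⟨_⟩ {I = I} M = ⋃ I (λ i → 2^ (M i))

  -- H is recovered from its maximal components (the inclusion converse to this
  -- one holds for every downward-closed H).  This is automatic when ℬ is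
  -- finite, but not in general: the compset of all finite subsets of ℕ has no
  -- maximal component.
  GeneratedByMaximals : Compset ℬ → Set (suc ℓ)
  GeneratedByMaximals H = H ⊆ ⟨ (λ (M : ∃ (maximal H)) → proj₁ M) ⟩

  Conic : ℕ → Compset ℬ → Set (suc ℓ)
  Conic k H = DownwardClosed H × Inverse (setoid (Fin k)) (Maximals H)

  IsQuotient : Compset ℬ → Compset ℬ → Compset ℬ → Set (suc (suc ℓ))
  IsQuotient H H′ Hq =
    DownwardClosed Hq × (H′ ⊗ Hq) ⊆ H ×
    (∀ (K : Compset ℬ) → DownwardClosed K → (H′ ⊗ K) ⊆ H → K ⊆ Hq)

  quotientFormula : Compset ℬ → Compset ℬ → Compset ℬ
  quotientFormula H H′ =
    ⟨ (λ (φ : Func (Maximals H′) (Maximals H)) →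
         ⋂ (∃ (maximal H′)) (λ M′ → proj₁ (φ ⟨$⟩ M′) ÷ proj₁ M′)) ⟩

{-# OPTIONS --safe #-}

-- M′ ∩ X lies below a maximal component φ(M′) of H exactly when X ⊆ φ(M′) ÷ M′;
-- choosing φ(M′) for every maximal M′ of H′ at once gives the formula.  In the
-- conic case there are k ^ k′ choice functions φ, and every maximal component of
-- the quotient is the intersection attached to one of them.

module Submission where

open import Defs
open import Level using (Level; suc; _⊔_; Lift; lift; lower)
open import Axiom.ExcludedMiddle using (ExcludedMiddle)
open import Data.Fin using (Fin; zero; finToFun; funToFin)
import Data.Fin as Fin
open import Data.Fin.Properties using (finToFun-funToFin; ¬Fin0)
open import Data.Nat using (ℕ; _≤_; _^_; z≤n; s≤s)
import Data.Nat as ℕ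
open import Data.Nat.Properties using (m≤n⇒m≤1+n)
open import Data.Product using (∃; ∃-syntax; _×_; _,_; proj₁; proj₂)
open import Data.Sum using (inj₁; inj₂; map₁; map₂)
open import Function using (_∘_; id)
open import Function.Bundles using (Func; Inverse; _⟨$⟩_)
import Function.Consequences.Setoid as Consequences
open import Relation.Binary.Bundles using (Setoid)
import Relation.Binary.Construct.On as On
import Relation.Binary.Definitions as Binary
open import Relation.Binary.PropositionalEquality as ≡ using (_≡_; refl)
open import Relation.Nullary using (yes; no; ¬_; ¬?; contradiction; _×-dec_)
open import Relation.Nullary.Decidable using (map′)
open import Relation.Unary using (Pred; Decidable; _∈_; _⊆_; _≐_; _∩_; ∁; ⋂)
open import Relation.Unary.Relation.Binary.Equality using (≐-setoid)

lowerExcludedMiddle : ∀ {a} b → ExcludedMiddle (a ⊔ b) → ExcludedMiddle a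
lowerExcludedMiddle b em {P} = map′ lower lift (em {P = Lift b P})

module _ {a b} (S : Setoid a b) (_≟_ : Binary.Decidable (Setoid._≈_ S)) where

  open Setoid S using (Carrier; _≈_; sym; trans)

  private
    -- For `S` the setoid of components and `P` the predicate `maximal Hq`, this is definitionally
    -- `Maximals Hq`, so an enumeration of `Sub P` is what `Conic` asks for.
    Sub : ∀ {p} → Pred Carrier p → Setoid (a ⊔ p) b
    Sub P = On.setoid {B = ∃ P} S proj₁

  Fin↔∅ : ∀ {p} {P : Pred Carrier p} → (∀ {x} → ¬ P x) →
          Inverse (≡.setoid (Fin 0)) (Sub P)
  Fin↔∅ empty = record
    { to        = λ ()
    ; from      = λ (_ , px) → contradiction px empty
    ; to-cong   = λ { {()} }
    ; from-cong = λ { {_ , px} → contradiction px empty }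
    ; inverse   = (λ { {_ , px} → contradiction px empty }) , λ { {()} }
    }

  -- The class of `x₀` takes index `zero` and the rest is shifted by one. Equality ignores the
  -- proofs of `P`, so `px₀` can stand for the whole class.
  adjoin : ∀ {p} {P : Pred Carrier p} {n x₀} → P x₀ →
           Inverse (≡.setoid (Fin n)) (Sub (P ∩ ∁ (_≈ x₀))) →
           Inverse (≡.setoid (Fin (ℕ.suc n))) (Sub P)
  adjoin {P = P} {n} {x₀} px₀ I = record
    { to        = to
    ; from      = from
    ; to-cong   = to-cong
    ; from-cong = λ {x} {y} → from-cong x y
    ; inverse   = strictlyInverseˡ⇒inverseˡ {to} {from} (λ {i} {j} → to-cong {i} {j}) to∘from ,
                  strictlyInverseʳ⇒inverseʳ {f = to} (λ {x} {y} → from-cong x y) from∘to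
    }
    where
    open Consequences (≡.setoid (Fin (ℕ.suc n))) (Sub P)
    module I = Inverse I

    to : Fin (ℕ.suc n) → ∃ P
    to zero        = x₀ , px₀
    to (Fin.suc i) = let x , px , _ = I.to i in x , px

    from : ∃ P → Fin (ℕ.suc n)
    from (x , px) with x ≟ x₀
    ... | yes _    = zero
    ... | no  x≉x₀ = Fin.suc (I.from (x , px , x≉x₀))

    to-cong : ∀ {i j} → i ≡ j → proj₁ (to i) ≈ proj₁ (to j)
    to-cong refl = Setoid.refl S

    from-cong : ∀ x y → proj₁ x ≈ proj₁ y → from x ≡ from y
    from-cong (x , _) (y , _) x≈y with x ≟ x₀ | y ≟ x₀
    ... | yes _    | yes _    = refl
    ... | yes x≈x₀ | no  y≉x₀ = contradiction (trans (sym x≈y) x≈x₀) y≉x₀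
    ... | no  x≉x₀ | yes y≈x₀ = contradiction (trans x≈y y≈x₀) x≉x₀
    ... | no  _    | no  _    = ≡.cong Fin.suc (I.from-cong x≈y)

    to∘from : ∀ x → proj₁ (to (from x)) ≈ proj₁ x
    to∘from (x , px) with x ≟ x₀
    ... | yes x≈x₀ = sym x≈x₀
    ... | no  x≉x₀ = I.strictlyInverseˡ (x , px , x≉x₀)

    from∘to : ∀ i → from (to i) ≡ i
    from∘to zero with x₀ ≟ x₀
    ... | yes _     = refl
    ... | no  x₀≉x₀ = contradiction (Setoid.refl S) x₀≉x₀
    from∘to (Fin.suc i) with proj₁ (I.to i) ≟ x₀
    ... | yes x≈x₀ = contradiction x≈x₀ (proj₂ (proj₂ (I.to i)))
    ... | no  _    = ≡.cong Fin.suc (I.strictlyInverseʳ i)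

  -- Induction along the list `D`, which may repeat itself and may leave `P`. A head outside `P` is
  -- dropped. A head inside `P` is counted and its whole class is removed from `P`, so later
  -- repetitions fail the test and are dropped too.
  covered⇒finite : ∀ {p} {P : Pred Carrier p} → Decidable P → P Binary.Respects _≈_ →
                   ∀ {N} (D : Fin N → Carrier) → (∀ {x} → P x → ∃[ i ] D i ≈ x) →
                   ∃[ n ] (n ≤ N × Inverse (≡.setoid (Fin n)) (Sub P))
  covered⇒finite P? resp {ℕ.zero} D cover =
    0 , z≤n , Fin↔∅ λ px → ¬Fin0 (proj₁ (cover px))
  covered⇒finite {P = P} P? resp {ℕ.suc N} D cover with P? (D zero)
  ... | no ¬p =
    let n , n≤N , I = covered⇒finite P? resp (D ∘ Fin.suc) cover′
    in  n , m≤n⇒m≤1+n n≤N , I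
    where
    cover′ : ∀ {x} → P x → ∃[ i ] D (Fin.suc i) ≈ x
    cover′ px with cover px
    ... | zero      , D₀≈x = contradiction (resp (sym D₀≈x) px) ¬p
    ... | Fin.suc i , Dᵢ≈x = i , Dᵢ≈x
  ... | yes p₀ =
    let n , n≤N , I = covered⇒finite P′? resp′ (D ∘ Fin.suc) cover′
    in  ℕ.suc n , s≤s n≤N , adjoin p₀ I
    where
    P′? : Decidable (P ∩ ∁ (_≈ D zero))
    P′? x = P? x ×-dec ¬? (x ≟ D zero)

    resp′ : (P ∩ ∁ (_≈ D zero)) Binary.Respects _≈_
    resp′ x≈y (px , x≉D₀) = resp x≈y px , x≉D₀ ∘ trans x≈y

    cover′ : ∀ {x} → (P ∩ ∁ (_≈ D zero)) x → ∃[ i ] D (Fin.suc i) ≈ x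
    cover′ (px , x≉D₀) with cover px
    ... | zero      , D₀≈x = contradiction (sym D₀≈x) x≉D₀
    ... | Fin.suc i , Dᵢ≈x = i , Dᵢ≈x

module _ {ℓ : Level} {ℬ : Set ℓ} where

  ÷-elim : (M M′ : Component ℬ) → M′ ∩ (M ÷ M′) ⊆ M
  ÷-elim M M′ (_    , inj₁ x∈M)  = x∈M
  ÷-elim M M′ (x∈M′ , inj₂ x∉M′) = contradiction x∈M′ x∉M′

  -- The classical half of the adjunction: since `÷` is a union with a complement, membership in
  -- `M′` has to be decided.
  ÷-intro : ExcludedMiddle ℓ → {X : Component ℬ} (M M′ : Component ℬ) →
            M′ ∩ X ⊆ M → X ⊆ M ÷ M′
  ÷-intro em M M′ M′∩X⊆M {x} x∈X with em {P = x ∈ M′}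
  ... | yes x∈M′ = inj₁ (M′∩X⊆M (x∈M′ , x∈X))
  ... | no  x∉M′ = inj₂ x∉M′

  -- Compsets need not respect `≐`; downward closure is what carries membership in `H` from `M` to
  -- `N`.
  maximal-resp-≐ : {H : Compset ℬ} → DownwardClosed H → maximal H Binary.Respects _≐_
  maximal-resp-≐ dc (M⊆N , N⊆M) (M∈H , max) = dc N⊆M M∈H , λ N′∈H N⊆N′ →
    let N′⊆M , M⊆N′ = max N′∈H (N⊆N′ ∘ M⊆N) in M⊆N ∘ N′⊆M , M⊆N′ ∘ N⊆M

  quotientFormula-isQuotient :
    ExcludedMiddle ℓ → Choice (suc ℓ) ℓ ℓ → {H H′ : Compset ℬ} →
    DownwardClosed H → GeneratedByMaximals H → GeneratedByMaximals H′ →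
    IsQuotient H H′ (quotientFormula H H′)
  quotientFormula-isQuotient em choice {H} {H′} dc gen gen′ =
    (λ M′⊆M (φ , M⊆) → φ , M⊆ ∘ M′⊆M) , composite⊆H , largest
    where
    composite⊆H : (H′ ⊗ quotientFormula H H′) ⊆ H
    composite⊆H (M , X , M∈H′ , (φ , X⊆) , Y⊆M∩X , _) =
      -- The formula constrains `X` only at maximal components, so `M` is first enlarged to a
      -- maximal `N`.
      let N , M⊆N = gen′ M∈H′
      in  dc (λ y∈Y → let y∈M , y∈X = Y⊆M∩X y∈Y in
                      ÷-elim (proj₁ (φ ⟨$⟩ N)) (proj₁ N) (M⊆N y∈M , X⊆ y∈X N))
             (proj₁ (proj₂ (φ ⟨$⟩ N)))

    largest : ∀ K → DownwardClosed K → (H′ ⊗ K) ⊆ H → K ⊆ quotientFormula H H′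
    largest K _ H′⊗K⊆H {X} X∈K =
      -- Each `M′ ∩ X` is a member of `H′ ⊗ K`, hence of `H`, and so lies below some maximal
      -- component; choice picks one for all `M′` compatibly with `≐`.
      let φ , M′∩X⊆φ = choice (Maximals H′) (Maximals H)
            (λ M′ M → proj₁ M′ ∩ X ⊆ proj₁ M)
            (λ (_ , N′⊆M′) sub (x∈N′ , x∈X) → sub (N′⊆M′ x∈N′ , x∈X))
            (λ (M⊆N , _) sub → M⊆N ∘ sub)
            (λ (M′ , M′∈H′ , _) →
              gen (H′⊗K⊆H (M′ , X , M′∈H′ , X∈K , id , id)))
      in  φ , λ x∈X M′ → ÷-intro em (proj₁ (φ ⟨$⟩ M′)) (proj₁ M′) (M′∩X⊆φ M′) x∈X

  IsQuotient-unique : {H H′ Hq Hq′ : Compset ℬ} →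
                      IsQuotient H H′ Hq → IsQuotient H H′ Hq′ → Hq ⊆ Hq′
  IsQuotient-unique (dc , sub , _) (_ , _ , largest) = largest _ dc sub

  module _ {H H′ : Compset ℬ} {k k′ : ℕ}
           (I  : Inverse (≡.setoid (Fin k))  (Maximals H))
           (I′ : Inverse (≡.setoid (Fin k′)) (Maximals H′)) where

    private
      module I  = Inverse I
      module I′ = Inverse I′

    -- Indexing the intersection by Fin k′ instead of the maximal components of
    -- H′ keeps it in the universe of components.
    choiceComponent : Fin (k ^ k′) → Component ℬ
    choiceComponent c =
      ⋂ (Fin k′) (λ i → proj₁ (I.to (finToFun c i)) ÷ proj₁ (I′.to i))

    choiceComponent∈quotientFormula : ∀ c → choiceComponent c ∈ quotientFormula H H′
    choiceComponent∈quotientFormula c = φ , λ {x} x∈ M′ →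
      -- Reindexing by `I′.from` returns `M′` only up to `≐`. The numerators agree on the nose; the
      -- complement is transported contravariantly.
      map₂ (_∘ proj₂ (I′.strictlyInverseˡ M′) {x}) (x∈ (I′.from M′))
      where
      φ : Func (Maximals H′) (Maximals H)
      φ = record
        { to   = I.to ∘ finToFun c ∘ I′.from
        ; cong = I.to-cong ∘ ≡.cong (finToFun c) ∘ I′.from-cong
        }

    ⊆choiceComponent : ∀ {X} → X ∈ quotientFormula H H′ → ∃[ c ] X ⊆ choiceComponent c
    -- The code `c` tabulates `φ` along the two enumerations. Here the denominators agree on the
    -- nose, and only the numerator is recovered up to `≐`.
    ⊆choiceComponent (φ , X⊆) = funToFin f , λ {x} x∈X i →
      map₁ (φ⊆ i {x}) (X⊆ x∈X (I′.to i))
      where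
      f : Fin k′ → Fin k
      f i = I.from (φ ⟨$⟩ I′.to i)

      φ⊆ : ∀ i → proj₁ (φ ⟨$⟩ I′.to i) ⊆ proj₁ (I.to (finToFun (funToFin f) i))
      φ⊆ i = proj₂ (I.inverseˡ (finToFun-funToFin f i))

    -- `M` lies below some `choiceComponent c`, which itself belongs to `Hq`, so maximality forces
    -- equality.
    maximal≐choiceComponent :
      ∀ {Hq} → Hq ⊆ quotientFormula H H′ → quotientFormula H H′ ⊆ Hq →
      ∀ {M} → M ∈ maximal Hq → ∃[ c ] choiceComponent c ≐ M
    maximal≐choiceComponent Hq⊆ ⊆Hq (M∈Hq , max) =
      let c , M⊆ = ⊆choiceComponent (Hq⊆ M∈Hq)
      in  c , max (⊆Hq (choiceComponent∈quotientFormula c)) M⊆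

mainTheorem11 : ∀ {ℓ : Level} →
    ExcludedMiddle (suc ℓ) → Choice (suc ℓ) ℓ ℓ →
    (ℬ : Set ℓ) (H H′ : Compset ℬ) →
    DownwardClosed H → DownwardClosed H′ →
    GeneratedByMaximals H → GeneratedByMaximals H′ →
    IsQuotient H H′ (quotientFormula H H′) ×
    (∀ (k k′ : ℕ) → Conic k H → Conic k′ H′ →
    ∀ (Hq : Compset ℬ) → IsQuotient H H′ Hq →
    ∃[ n ] (n ≤ k ^ k′ × Conic n Hq))
mainTheorem11 {ℓ} em choice ℬ H H′ dc _ gen gen′ =
  isQuotient , λ k k′ (_ , I) (_ , I′) Hq isQuotient′@(dcq , _) →
    let n , n≤k^k′ , Iq =
          -- The `k ^ k′` candidates may coincide or fail to be maximal, hence only a bound.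
          -- Excluded middle decides both `≐` and maximality.
          covered⇒finite (≐-setoid ℬ ℓ) (λ _ _ → emℓ) (λ _ → em)
            (maximal-resp-≐ {H = Hq} dcq) (choiceComponent {H = H} {H′} I I′)
            (maximal≐choiceComponent I I′ {Hq}
              (IsQuotient-unique {Hq′ = quotientFormula H H′} isQuotient′ isQuotient)
              (IsQuotient-unique {Hq′ = Hq} isQuotient isQuotient′))
    in  n , n≤k^k′ , (λ {M} {M′} → dcq {M} {M′}) , Iq
  where
  emℓ : ExcludedMiddle ℓ
  emℓ = lowerExcludedMiddle (suc ℓ) em

  isQuotient : IsQuotient H H′ (quotientFormula H H′)
  isQuotient = quotientFormula-isQuotient emℓ choice {H} {H′} dc gen gen′
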